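{- For $n\ge 0$ let $s_n=\sum_{r=0}^{n}1/r!$. For every positive integer $k$ there exists a constant $n(k)$ such that for all $n\ge n(k)$, among the $k$ consecutive partial sums $s_n, s_{n+1},\dots,s_{n+k-1}$ at most two are convergents of the simple continued fraction expansion of $e$.
   Context: The convergents of $e$ are the rationals obtained by truncating the simple continued fraction expansion of $e$; a partial sum $s_n$ "is a convergent" if it equals one of these rationals. -}

module Defs where

open import Algebra.Properties.Group using (⁻¹-anti-homo-//)
open import Data.Fin.Base using (Fin)
open import Data.Fin.Subset using (_∈_; ∣_∣)
open import Data.Integer.Base as ℤ using (ℤ; +0; +[1+_]; 1ℤ)
import Data.Integer.Properties as ℤ
open import Data.Nat.Base as ℕ using (ℕ; zero; suc; _!)
open import Data.Nat.Coprimality using (Coprime)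
import Data.Nat.Properties as ℕ
open import Data.Nat.Properties using (_!≢0)
open import Data.Product.Base using (∃-syntax; _×_; _,_)
open import Data.Rational.Base
  using (ℚ; mkℚ; 0ℚ; _/_; _+_; _-_; -_; 1/_; _≤_; _<_; *<*; Positive; toℚᵘ)
  renaming (∣_∣ to ∣_∣ℚ)
import Data.Rational.Properties as ℚ
open import Data.Rational.Unnormalised.Base as ℚᵘ using (mkℚᵘ)
import Data.Rational.Unnormalised.Properties as ℚᵘ
open import Data.Sum.Base using (inj₁; inj₂)
open import Function.Base using (_∘_)
open import Relation.Binary.PropositionalEquality

IsCauchy : (ℕ → ℚ) → Set
IsCauchy u = ∀ ε → 0ℚ < ε → ∃[ N ] (∀ m n → N ℕ.≤ m → N ℕ.≤ n → ∣ u m - u n ∣ℚ < ε)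

-- Two such sequences stand for the same real when their difference tends to 0.
record ℝ : Set where
  field
    approx : ℕ → ℚ
    cauchy : IsCauchy approx

-- Since x is the class of its approximating sequence, the rationals u n tend
-- to x exactly when u n - approx x n tends to 0.
_ConvergesTo_ : (ℕ → ℚ) → ℝ → Set
u ConvergesTo x =
  ∀ ε → 0ℚ < ε → ∃[ N ] (∀ n → N ℕ.≤ n → ∣ u n - ℝ.approx x n ∣ℚ < ε)

-- Only infinite ones: these are the expansions of irrational numbers.
record SimpleContinuedFraction : Set where
  field
    a   : ℕ → ℤ
    a>0 : ∀ i → ℤ.Positive (a (suc i))

-- nested b _ n = [ b 0 ; b 1 , … , b n ]
nested     : (b : ℕ → ℤ) → (∀ i → ℤ.Positive (b i)) → ℕ → ℚ
nested-pos : ∀ b b>0 n → Positive (nested b b>0 n)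

nested b b>0 zero    = b 0 / 1
nested b b>0 (suc n) = b 0 / 1 + (1/ rest) {{ℚ.pos⇒nonZero rest {{rest>0}}}}
  where
  rest   = nested (b ∘ suc) (b>0 ∘ suc) n
  rest>0 = nested-pos (b ∘ suc) (b>0 ∘ suc) n

integer-pos : ∀ z → ℤ.Positive z → Positive (z / 1)
integer-pos +[1+ n ] _ = ℚ.normalize-pos (suc n) 1

nested-pos b b>0 zero    = integer-pos (b 0) (b>0 0)
nested-pos b b>0 (suc n) =
  ℚ.pos+pos⇒pos (b 0 / 1) {{integer-pos (b 0) (b>0 0)}}
    ((1/ rest) {{ℚ.pos⇒nonZero rest {{rest>0}}}}) {{ℚ.1/pos⇒pos rest {{rest>0}}}}
  where
  rest   = nested (b ∘ suc) (b>0 ∘ suc) n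
  rest>0 = nested-pos (b ∘ suc) (b>0 ∘ suc) n

-- truncate c n = [ a 0 ; a 1 , … , a n ], where a 0 may be any integer
truncate : SimpleContinuedFraction → ℕ → ℚ
truncate c zero    = SimpleContinuedFraction.a c 0 / 1
truncate c (suc n) = a 0 / 1 + (1/ rest) {{ℚ.pos⇒nonZero rest {{rest>0}}}}
  where
  open SimpleContinuedFraction c
  rest   = nested (a ∘ suc) a>0 n
  rest>0 = nested-pos (a ∘ suc) a>0 n

-- The value of an infinite continued fraction is the limit of its truncations.
_IsExpansionOf_ : SimpleContinuedFraction → ℝ → Set
c IsExpansionOf x = truncate c ConvergesTo x

_IsConvergentOf_ : ℚ → ℝ → Set
q IsConvergentOf x = ∃[ c ] (c IsExpansionOf x × ∃[ m ] q ≡ truncate c m)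

inv! : ℕ → ℚ
inv! r = (1ℤ / (r !)) {{r !≢0}}

-- s n = Σ_{r=0}^{n} 1/r!
s : ℕ → ℚ
s zero    = inv! 0
s (suc n) = s n + inv! (suc n)

unit< : ∀ p d .(c : Coprime (suc p) (suc d)) m .{{_ : ℕ.NonZero m}} →
        suc d ℕ.< m → 1ℤ / m < mkℚ +[1+ p ] d c
unit< p d c (suc m) d<m = ℚ.toℚᵘ-cancel-< (begin-strict
  toℚᵘ (1ℤ / suc m)  ≃⟨ ℚ.toℚᵘ-fromℚᵘ (mkℚᵘ 1ℤ m) ⟩
  mkℚᵘ 1ℤ m          <⟨ ℚᵘ.*<* (subst₂ ℤ._<_ (ℤ.pos-* 1 (suc d)) (ℤ.pos-* (suc p) (suc m))
                          (ℤ.+<+ (ℕ.<-≤-trans (subst (ℕ._< suc m) (sym (ℕ.*-identityˡ (suc d))) d<m)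
                                              (ℕ.m≤n*m (suc m) (suc p))))) ⟩
  mkℚᵘ +[1+ p ] d    ∎)
  where open ℚᵘ.≤-Reasoning

unit-double : ∀ m n .{{_ : ℕ.NonZero m}} .{{_ : ℕ.NonZero n}} →
              n ℕ.+ n ℕ.≤ m → 1ℤ / m + 1ℤ / m ≤ 1ℤ / n
unit-double (suc m) (suc n) 2n≤m = ℚ.toℚᵘ-cancel-≤ (begin
  toℚᵘ (1ℤ / M + 1ℤ / M)            ≃⟨ ℚ.toℚᵘ-homo-+ (1ℤ / M) (1ℤ / M) ⟩
  toℚᵘ (1ℤ / M) ℚᵘ.+ toℚᵘ (1ℤ / M)  ≃⟨ ℚᵘ.+-cong (ℚ.toℚᵘ-fromℚᵘ 1/M) (ℚ.toℚᵘ-fromℚᵘ 1/M) ⟩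
  1/M ℚᵘ.+ 1/M                      ≤⟨ ℚᵘ.*≤* (ℤ.+≤+ arith) ⟩
  mkℚᵘ 1ℤ n                         ≃⟨ ℚ.toℚᵘ-fromℚᵘ (mkℚᵘ 1ℤ n) ⟨
  toℚᵘ (1ℤ / N)                     ∎)
  where
  open ℚᵘ.≤-Reasoning
  M = suc m
  N = suc n
  1/M = mkℚᵘ 1ℤ m
  arith : (1 ℕ.* M ℕ.+ 1 ℕ.* M) ℕ.* N ℕ.≤ 1 ℕ.* (M ℕ.* M)
  arith = R.begin
    (1 ℕ.* M ℕ.+ 1 ℕ.* M) ℕ.* N  R.≡⟨ cong (λ x → (x ℕ.+ x) ℕ.* N) (ℕ.*-identityˡ M) ⟩
    (M ℕ.+ M) ℕ.* N              R.≡⟨ ℕ.*-distribʳ-+ N M M ⟩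
    M ℕ.* N ℕ.+ M ℕ.* N          R.≡⟨ ℕ.*-distribˡ-+ M N N ⟨
    M ℕ.* (N ℕ.+ N)              R.≤⟨ ℕ.*-monoʳ-≤ M 2n≤m ⟩
    M ℕ.* M                      R.≡⟨ ℕ.*-identityˡ (M ℕ.* M) ⟨
    1 ℕ.* (M ℕ.* M)              R.∎
    where module R = ℕ.≤-Reasoning

inv!-nonNeg : ∀ n → 0ℚ ≤ inv! n
inv!-nonNeg n = ℚ.<⇒≤ (ℚ.positive⁻¹ (inv! n) {{ℚ.normalize-pos 1 (n !) {{n !≢0}}}})

inv!-double : ∀ n → inv! (2 ℕ.+ n) + inv! (2 ℕ.+ n) ≤ inv! (1 ℕ.+ n)
inv!-double n = unit-double ((2 ℕ.+ n) !) ((1 ℕ.+ n) !) {{(2 ℕ.+ n) !≢0}} {{(1 ℕ.+ n) !≢0}}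
  (ℕ.+-monoʳ-≤ ((1 ℕ.+ n) !) (ℕ.m≤m+n ((1 ℕ.+ n) !) _))

s-mono : ∀ {m n} → m ℕ.≤′ n → s m ≤ s n
s-mono ℕ.≤′-refl               = ℚ.≤-refl
s-mono (ℕ.≤′-step {n} m≤n) =
  ℚ.≤-trans (s-mono m≤n)
    (subst (_≤ s (suc n)) (ℚ.+-identityʳ (s n)) (ℚ.+-monoʳ-≤ (s n) (inv!-nonNeg (suc n))))

s+inv!-anti : ∀ {m n} → suc m ℕ.≤′ n → s n + inv! n ≤ s (suc m) + inv! (suc m)
s+inv!-anti ℕ.≤′-refl                  = ℚ.≤-refl
s+inv!-anti (ℕ.≤′-step {zero} m<0)     with () ← ℕ.≤′⇒≤ m<0
s+inv!-anti (ℕ.≤′-step {suc n} m<1+n) =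
  ℚ.≤-trans
    (subst (_≤ s (suc n) + inv! (suc n)) (sym (ℚ.+-assoc (s (suc n)) _ _))
      (ℚ.+-monoʳ-≤ (s (suc n)) (inv!-double n)))
    (s+inv!-anti m<1+n)

s-between : ∀ {m n} → suc m ℕ.≤ n → s n ≤ s (suc m) + inv! (suc m)
s-between {m} {n} m<n =
  ℚ.≤-trans (subst (_≤ s n + inv! n) (ℚ.+-identityʳ (s n)) (ℚ.+-monoʳ-≤ (s n) (inv!-nonNeg n)))
            (s+inv!-anti (ℕ.≤⇒≤′ m<n))

diff≤ : ∀ {x y l d} → x ≤ l + d → l ≤ y → x - y ≤ d
diff≤ {x} {y} {l} {d} x≤l+d l≤y = begin
  x - y          ≤⟨ ℚ.+-mono-≤ x≤l+d (ℚ.neg-antimono-≤ l≤y) ⟩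
  (l + d) - l    ≡⟨ cong (_- l) (ℚ.+-comm l d) ⟩
  (d + l) - l    ≡⟨ ℚ.+-assoc d l (- l) ⟩
  d + (l - l)    ≡⟨ cong (d +_) (ℚ.+-inverseʳ l) ⟩
  d + 0ℚ         ≡⟨ ℚ.+-identityʳ d ⟩
  d              ∎
  where open ℚ.≤-Reasoning

∣diff∣≤ : ∀ {x y l d} → l ≤ x → x ≤ l + d → l ≤ y → y ≤ l + d → ∣ x - y ∣ℚ ≤ d
∣diff∣≤ {x} {y} l≤x x≤u l≤y y≤u with ℚ.∣p∣≡p∨∣p∣≡-p (x - y)
... | inj₁ eq = subst (_≤ _) (sym eq) (diff≤ x≤u l≤y)
... | inj₂ eq = subst (_≤ _) (sym (trans eq neg)) (diff≤ y≤u l≤x)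
  where
  neg : - (x - y) ≡ y - x
  neg = ⁻¹-anti-homo-// ℚ.+-0-group x y

n≤n! : ∀ n → n ℕ.≤ n !
n≤n! zero    = ℕ.z≤n
n≤n! (suc n) = ℕ.m≤m*n (suc n) (n !) {{n !≢0}}

s-cauchy : IsCauchy s
s-cauchy (mkℚ +0 _ _)            (*<* (ℤ.+<+ ()))
s-cauchy (mkℚ ℤ.-[1+ _ ] _ _)  (*<* ())
s-cauchy (mkℚ +[1+ p ] d c)    _ = N , λ m n N≤m N≤n →
  ℚ.≤-<-trans
    (∣diff∣≤ (s-mono (ℕ.≤⇒≤′ N≤m)) (s-between N≤m) (s-mono (ℕ.≤⇒≤′ N≤n)) (s-between N≤n))
    (unit< p d c (N !) {{N !≢0}} (n≤n! N))
  where N = suc (suc d)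

-- e is the sum of the series Σ 1/r!.
e : ℝ
e = record { approx = s ; cauchy = s-cauchy }

-- P need not be decidable, so {i | P i} cannot be counted directly; instead,
-- every finite set of indices satisfying P has at most m elements.
AtMost : ∀ {k} → ℕ → (Fin k → Set) → Set
AtMost m P = ∀ A → (∀ i → i ∈ A → P i) → ∣ A ∣ ℕ.≤ m

module Submission where

-- Write s n = A n / n! and D n = gcd (A n) (n !).  A convergent p/q of e satisfies
-- |e - p/q| ≤ 1/q², whereas |e - s n| > 1/(n+1)!; so if s n is a convergent, then
-- q² ≤ 2 (n+1)! and n ! ≤ 2 (n+1) (D n)².  For n < m, on the other hand, A m is congruent
-- modulo A n to a positive number that is polynomially bounded in n for fixed m - n, so that
-- D n and D m have a small common divisor.  Three convergents among k consecutive partial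
-- sums would thus give three divisors of (n+k)!, each about √(n!) and nearly coprime in
-- pairs; their product, about (n!)^(3/2), is too large for that.

open import Defs
open import Data.Empty using (⊥)
open import Data.Fin.Base as Fin using (Fin; toℕ)
open import Data.Fin.Subset using (Subset; inside; outside; _∈_; ∣_∣)
import Data.Fin.Properties as Fin
open import Data.Integer.Base as ℤ using (ℤ; +[1+_])

open import Data.Nat.Base as ℕ using (ℕ; zero; suc; z≤n; s≤s; z<s; s<s; _!)
import Data.Nat.Divisibility as ℕ
import Data.Nat.Properties as ℕ
open import Data.Nat.Properties using (_!≢0)
open import Data.Product.Base using (∃-syntax; _×_; _,_; proj₁; proj₂)
open import Data.Rational.Base using (ℚ)
open import Data.Sum.Base using (inj₁; inj₂)
open import Data.Vec.Base using ([]; _∷_; here; there)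
open import Function.Base using (_∘_)
open import Relation.Binary.PropositionalEquality

module Arithmetic where

  open import Data.Nat.Base using (NonZero; _+_; _*_; _∸_; _^_; _≤_; _<_; >-nonZero; >-nonZero⁻¹; ≢-nonZero; ≢-nonZero⁻¹)
  open import Data.Nat.Properties hiding (_!≢0)
  open import Data.Nat.Divisibility
  open import Data.Nat.GCD
  open import Data.Nat.LCM using (lcm; lcm-least; gcd*lcm)
  open import Data.Nat.Tactic.RingSolver using (solve-∀)

  -- Divisibility: the product of three divisors of one number.

  gcd-submultiplicative : ∀ a b c → gcd (a * b) c ∣ gcd a c * gcd b c
  gcd-submultiplicative a b c =
    -- `gcd a c * gcd b c` is the gcd of `gcd a c * b` and `gcd a c * c`, and `d` divides both.
    subst (d ∣_) (sym (c*gcd[m,n]≡gcd[cm,cn] (gcd a c) b c))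
      (gcd-greatest d∣gcd[a,c]*b (∣n⇒∣m*n (gcd a c) d∣c))
    where
    d = gcd (a * b) c
    d∣c = gcd[m,n]∣n (a * b) c
    d∣gcd[a,c]*b : d ∣ gcd a c * b
    d∣gcd[a,c]*b = subst (d ∣_) (trans (sym (c*gcd[m,n]≡gcd[cm,cn] b a c)) (*-comm b (gcd a c)))
      (gcd-greatest (subst (d ∣_) (*-comm a b) (gcd[m,n]∣m (a * b) c)) (∣n⇒∣m*n b d∣c))

  gcd-monoˡ-∣ : ∀ {a b} c → a ∣ b → gcd a c ∣ gcd b c
  gcd-monoˡ-∣ {a} c a∣b = gcd-greatest (∣-trans (gcd[m,n]∣m a c) a∣b) (gcd[m,n]∣n a c)

  -- With `l = lcm a b`, apply gcd times lcm equals product twice: first to `a`, `b`, then to `l`,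
  -- `c`. The final lcm divides `L`, and `gcd l c` divides `gcd (a * b) c`, which splits by
  -- `gcd-submultiplicative`.
  product-of-divisors : ∀ {a b c L} → a ∣ L → b ∣ L → c ∣ L →
                        a * b * c ∣ gcd a b * (gcd a c * gcd b c * L)
  product-of-divisors {a} {b} {c} {L} a∣L b∣L c∣L =
    subst (_∣ gcd a b * (gcd a c * gcd b c * L)) (sym abc≡)
      (*-monoʳ-∣ (gcd a b) (*-pres-∣ gcd[l,c]∣ (lcm-least {l} {c} (lcm-least {a} {b} a∣L b∣L) c∣L)))
    where
    l = lcm a b
    gcd[l,c]∣ : gcd l c ∣ gcd a c * gcd b c
    gcd[l,c]∣ = ∣-trans (gcd-monoˡ-∣ c (lcm-least {a} {b} (m∣m*n b) (n∣m*n a))) (gcd-submultiplicative a b c)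
    abc≡ : a * b * c ≡ gcd a b * (gcd l c * lcm l c)
    abc≡ = begin
      a * b * c                        ≡⟨ cong (_* c) (gcd*lcm a b) ⟨
      gcd a b * l * c                  ≡⟨ *-assoc (gcd a b) l c ⟩
      gcd a b * (l * c)                ≡⟨ cong (gcd a b *_) (gcd*lcm l c) ⟨
      gcd a b * (gcd l c * lcm l c)    ∎
      where open ≡-Reasoning

  -- Common divisors of the numerators `A n`.

  -- A n = n! · s n
  A : ℕ → ℕ
  A zero    = 1
  A (suc n) = suc n * A n + 1

  -- A (j + n) ≡ B n j modulo A n
  B : ℕ → ℕ → ℕ
  B n zero    = 0
  B n (suc j) = suc (j + n) * B n j + 1

  -- `A (j + n)` and `B n j` satisfy the same recurrence in `j`, so they differ by a multiple of the
  -- starting value `A n`.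
  ∣A⇒∣B : ∀ {d} n j → d ∣ A n → d ∣ A (j + n) → d ∣ B n j
  ∣A⇒∣B {d} n j d∣An d∣A = ∣m+n∣m⇒∣n (subst (d ∣_) (A≡ j .proj₂) d∣A) (∣n⇒∣m*n (A≡ j .proj₁) d∣An)
    where
    A≡ : ∀ j → ∃[ c ] A (j + n) ≡ c * A n + B n j
    A≡ zero    = 1 , sym (trans (+-identityʳ _) (*-identityˡ (A n)))
    A≡ (suc j) with c , eq ← A≡ j =
      suc (j + n) * c , trans (cong (λ x → suc (j + n) * x + 1) eq) (distrib (suc (j + n)) c (A n) (B n j))
      where
      distrib : ∀ t c a b → t * (c * a + b) + 1 ≡ t * c * a + (t * b + 1)
      distrib = solve-∀

  -- The `+ 1` of the recurrence is absorbed by `1 ≤ T ^ j`; this raises the factor by one, still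
  -- within `T`.
  B≤T^j : ∀ {T} n j → j + n < T → B n j ≤ T ^ j
  B≤T^j n zero    _ = z≤n
  B≤T^j {T} n (suc j) j+n<T = begin
    suc (j + n) * B n j + 1           ≤⟨ +-mono-≤ (*-monoʳ-≤ (suc (j + n)) (B≤T^j n j (<⇒≤ j+n<T))) 1≤T^j ⟩
    suc (j + n) * T ^ j + T ^ j       ≡⟨ +-comm (suc (j + n) * T ^ j) (T ^ j) ⟩
    suc (suc (j + n)) * T ^ j         ≤⟨ *-monoˡ-≤ (T ^ j) j+n<T ⟩
    T * T ^ j                         ∎
    where
    open ≤-Reasoning
    1≤T^j : 1 ≤ T ^ j
    1≤T^j = m^n>0 T {{>-nonZero (≤-<-trans z≤n j+n<T)}} j

  -- Since `n < m`, the residue `B n (m ∸ n)` is positive, so a common divisor, which divides it,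
  -- cannot exceed it.
  common-divisor-bound : ∀ {d T k n m} → n < m → m < T → m ∸ n ≤ k → d ∣ A n → d ∣ A m → d ≤ T ^ k
  common-divisor-bound {d} {T} {k} {n} {m} n<m m<T m∸n≤k d∣An d∣Am = begin
    d        ≤⟨ ∣⇒≤ {{B≢0 (m<n⇒0<n∸m n<m)}} (∣A⇒∣B n j d∣An (subst (λ x → d ∣ A x) (sym m≡) d∣Am)) ⟩
    B n j    ≤⟨ B≤T^j n j (subst (_< T) (sym m≡) m<T) ⟩
    T ^ j    ≤⟨ ^-monoʳ-≤ T {{>-nonZero (≤-<-trans z≤n m<T)}} m∸n≤k ⟩
    T ^ k    ∎
    where
    open ≤-Reasoning
    j = m ∸ n
    m≡ : j + n ≡ m
    m≡ = m∸n+n≡m (<⇒≤ n<m)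
    B≢0 : ∀ {i} → 0 < i → NonZero (B n i)
    B≢0 {suc i} _ = >-nonZero (m≤n+m 1 (suc (i + n) * B n i))

  -- Growth of factorials.

  [k+n]!≤[k+n]^k*n! : ∀ k n → (k + n) ! ≤ (k + n) ^ k * n !
  [k+n]!≤[k+n]^k*n! zero    n = ≤-reflexive (sym (*-identityˡ (n !)))
  [k+n]!≤[k+n]^k*n! (suc k) n = begin
    T * (k + n) !                ≤⟨ *-monoʳ-≤ T ([k+n]!≤[k+n]^k*n! k n) ⟩
    T * ((k + n) ^ k * n !)      ≤⟨ *-monoʳ-≤ T (*-monoˡ-≤ (n !) (^-monoˡ-≤ k (n≤1+n (k + n)))) ⟩
    T * (T ^ k * n !)            ≡⟨ *-assoc T (T ^ k) (n !) ⟨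
    T * T ^ k * n !              ∎
    where
    open ≤-Reasoning
    T = suc k + n

  -- Each of the `j` largest factors of the factorial is at least `m`.
  m^j≤[j+m]! : ∀ m j → m ^ j ≤ (j + m) !
  m^j≤[j+m]! m zero    = >-nonZero⁻¹ (m !) {{m !≢0}}
  m^j≤[j+m]! m (suc j) = *-mono-≤ (m≤n+m m (suc j)) (m^j≤[j+m]! m j)

  *-^-distribʳ : ∀ a b c → (a * b) ^ c ≡ a ^ c * b ^ c
  *-^-distribʳ a b zero    = refl
  *-^-distribʳ a b (suc c) =
    trans (cong (a * b *_) (*-^-distribʳ a b c)) (interchange a b (a ^ c) (b ^ c))
    where
    interchange : ∀ a b x y → a * b * (x * y) ≡ a * x * (b * y)
    interchange = solve-∀

  -- The summand `2 * c` makes `m = n ∸ 2 * c` a genuine difference. The rest gives `9 * suc w ≤ m`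
  -- for `w = k + 2 * c`, whence 9 (k + n) = 9 (w + m) ≤ 9 (1 + w) m ≤ m².
  factorialThreshold : ℕ → ℕ → ℕ
  factorialThreshold k c = 9 * suc (k + 2 * c) + 2 * c

  -- With m = n - 2c we have n! ≥ (m²)ᶜ, and m² ≥ 9 (k + n) for large n.
  factorial-beats-power : ∀ k c .{{_ : NonZero c}} n → factorialThreshold k c ≤ n → 8 * (k + n) ^ c < n !
  factorial-beats-power k c n n₀≤n = begin-strict
    -- The 9 serves twice: it makes the inequality strict, and, being at most `9 ^ c` for positive
    -- `c`, it can be moved inside the power.
    8 * T ^ c          <⟨ *-monoˡ-< (T ^ c) {{m^n≢0 T c {{T≢0}}}} (n<1+n 8) ⟩
    9 * T ^ c          ≤⟨ *-monoˡ-≤ (T ^ c) (subst (_≤ 9 ^ c) (^-identityʳ 9) (^-monoʳ-≤ 9 (>-nonZero⁻¹ c))) ⟩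
    9 ^ c * T ^ c      ≡⟨ *-^-distribʳ 9 T c ⟨
    (9 * T) ^ c        ≤⟨ ^-monoˡ-≤ c 9T≤m² ⟩
    (m * m) ^ c        ≡⟨ cong (λ x → (m * x) ^ c) (*-identityʳ m) ⟨
    (m ^ 2) ^ c        ≡⟨ ^-*-assoc m 2 c ⟩
    m ^ (2 * c)        ≤⟨ m^j≤[j+m]! m (2 * c) ⟩
    (2 * c + m) !      ≡⟨ cong _! n≡ ⟩
    n !                ∎
    where
    open ≤-Reasoning
    w = k + 2 * c
    T = k + n
    m = n ∸ 2 * c
    n≡ : 2 * c + m ≡ n
    n≡ = m+[n∸m]≡n (≤-trans (m≤n+m (2 * c) (9 * suc w)) n₀≤n)
    9[1+w]≤m : 9 * suc w ≤ m
    9[1+w]≤m = subst (_≤ m) (m+n∸n≡m (9 * suc w) (2 * c)) (∸-monoˡ-≤ (2 * c) n₀≤n)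
    m≢0 : NonZero m
    m≢0 = >-nonZero (<-≤-trans z<s 9[1+w]≤m)
    T≡ : T ≡ w + m
    T≡ = trans (cong (k +_) (sym n≡)) (sym (+-assoc k (2 * c) m))
    T≢0 : NonZero T
    T≢0 = >-nonZero (subst (0 <_) (sym T≡) (<-≤-trans (>-nonZero⁻¹ m {{m≢0}}) (m≤n+m m w)))
    9T≤m² : 9 * T ≤ m * m
    9T≤m² = begin
      9 * T               ≡⟨ cong (9 *_) T≡ ⟩
      9 * (w + m)         ≤⟨ *-monoʳ-≤ 9 (+-monoˡ-≤ m (m≤m*n w m {{m≢0}})) ⟩
      9 * (w * m + m)     ≡⟨ cong (9 *_) (+-comm (w * m) m) ⟩
      9 * (suc w * m)     ≡⟨ *-assoc 9 (suc w) m ⟨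
      9 * suc w * m       ≤⟨ *-monoˡ-≤ m 9[1+w]≤m ⟩
      m * m               ∎

  -- Size contradiction for three large, nearly coprime divisors.

  -- a² ≥ F/(2T), and the same for b and c, whereas abc ≤ L E³.
  three-large-divisors : ∀ {a b c L E F T} .{{_ : NonZero L}} .{{_ : NonZero F}} →
    a ∣ L → b ∣ L → c ∣ L → L ≤ E * F →
    gcd a b ≤ E → gcd a c ≤ E → gcd b c ≤ E →
    F ≤ 2 * T * (a * a) → F ≤ 2 * T * (b * b) → F ≤ 2 * T * (c * c) →
    F ≤ 8 * (T ^ 3 * E ^ 8)
  three-large-divisors {a} {b} {c} {L} {E} {F} {T} a∣L b∣L c∣L L≤EF gab gac gbc Fa Fb Fc =
    -- The product of the three lower bounds is F³ ≤ 8 T³ (abc)². As abc ≤ E³ L ≤ E⁴ F, the right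
    -- side is at most 8 T³ E⁸ F², and F² cancels.
    *-cancelʳ-≤ F _ (F * F) {{m*n≢0 F F}} (begin
      F * (F * F)                                     ≤⟨ *-mono-≤ Fa (*-mono-≤ Fb Fc) ⟩
      2 * T * (a * a) * (2 * T * (b * b) * (2 * T * (c * c)))
                                                      ≡⟨ collect T a b c ⟩
      8 * T ^ 3 * (a * b * c * (a * b * c))           ≤⟨ *-monoʳ-≤ (8 * T ^ 3) (*-mono-≤ abc≤ abc≤) ⟩
      8 * T ^ 3 * (E * (E * E * (E * F)) * (E * (E * E * (E * F))))
                                                      ≡⟨ regroup T E F ⟩
      8 * (T ^ 3 * E ^ 8) * (F * F)                   ∎)
    where
    open ≤-Reasoning
    gcd≢0 : ∀ {x y} → x ∣ L → NonZero (gcd x y)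
    gcd≢0 {x} {y} x∣L = ≢-nonZero λ g≡0 →
      ≢-nonZero⁻¹ L (0∣⇒≡0 (subst (_∣ L) (gcd[m,n]≡0⇒m≡0 {x} {y} g≡0) x∣L))
    bound≢0 : NonZero (gcd a b * (gcd a c * gcd b c * L))
    bound≢0 = m*n≢0 _ _ {{gcd≢0 {a} {b} a∣L}}
      {{m*n≢0 _ L {{m*n≢0 _ _ {{gcd≢0 {a} {c} a∣L}} {{gcd≢0 {b} {c} b∣L}}}}}}
    abc≤ : a * b * c ≤ E * (E * E * (E * F))
    abc≤ = ≤-trans (∣⇒≤ {{bound≢0}} (product-of-divisors a∣L b∣L c∣L))
                   (*-mono-≤ gab (*-mono-≤ (*-mono-≤ gac gbc) L≤EF))
    collect : ∀ T a b c → 2 * T * (a * a) * (2 * T * (b * b) * (2 * T * (c * c)))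
                        ≡ 8 * (T * (T * (T * 1))) * (a * b * c * (a * b * c))
    collect = solve-∀
    regroup : ∀ T E F → 8 * (T * (T * (T * 1))) * (E * (E * E * (E * F)) * (E * (E * E * (E * F))))
                      ≡ 8 * (T * (T * (T * 1)) * (E * (E * (E * (E * (E * (E * (E * (E * 1))))))))) * (F * F)
    regroup = solve-∀

  -- Three elements of a finite set, in increasing order.

  least-element : ∀ {k j} (S : Subset k) → suc j ≤ ∣ S ∣ →
    ∃[ i ] i ∈ S × ∃[ S′ ] (∀ l → l ∈ S′ → l ∈ S × i Fin.< l) × j ≤ ∣ S′ ∣
  least-element (inside  ∷ S) (s≤s j≤) =
    Fin.zero , here , outside ∷ S , (λ { (Fin.suc l) (there l∈S) → there l∈S , z<s }) , j≤
  least-element (outside ∷ S) j< with i , i∈S , S′ , above , j≤ ← least-element S j< =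
    Fin.suc i , there i∈S , outside ∷ S′ ,
    (λ { (Fin.suc l) (there l∈S′) → let l∈S , i<l = above l l∈S′ in there l∈S , s<s i<l }) , j≤

  three-elements : ∀ {k} (S : Subset k) → 3 ≤ ∣ S ∣ →
    ∃[ h ] ∃[ i ] ∃[ j ] h ∈ S × i ∈ S × j ∈ S × h Fin.< i × i Fin.< j
  three-elements S 3≤
    with h , h∈S  , S₁ , above₁ , 2≤ ← least-element S 3≤
    with i , i∈S₁ , S₂ , above₂ , 1≤ ← least-element S₁ 2≤
    with j , j∈S₂ , _                ← least-element S₂ 1≤
    with j∈S₁ , i<j ← above₂ j j∈S₂ =
    h , i , j , h∈S , above₁ i i∈S₁ .proj₁ , above₁ j j∈S₁ .proj₁ , above₁ i i∈S₁ .proj₂ , i<j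

  -- Numerators and denominators of finite continued fractions.

  -- nested b _ n = num b n / den b n
  num den : (ℕ → ℤ) → ℕ → ℕ
  num b zero    = ℤ.∣ b 0 ∣
  num b (suc n) = ℤ.∣ b 0 ∣ * num (b ∘ suc) n + den (b ∘ suc) n
  den b zero    = 1
  den b (suc n) = num (b ∘ suc) n

  ∣pos∣ : ∀ z → ℤ.Positive z → NonZero ℤ.∣ z ∣
  ∣pos∣ +[1+ _ ] _ = _

  den≤num : ∀ b → (∀ i → ℤ.Positive (b i)) → ∀ n → den b n ≤ num b n
  den≤num b b>0 zero    = >-nonZero⁻¹ _ {{∣pos∣ (b 0) (b>0 0)}}
  den≤num b b>0 (suc n) =
    ≤-trans (m≤n*m _ ℤ.∣ b 0 ∣ {{∣pos∣ (b 0) (b>0 0)}}) (m≤m+n _ (den (b ∘ suc) n))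

  1≤num : ∀ b → (∀ i → ℤ.Positive (b i)) → ∀ n → 1 ≤ num b n
  1≤num b b>0 zero    = den≤num b b>0 zero
  1≤num b b>0 (suc n) = ≤-trans (1≤num (b ∘ suc) (b>0 ∘ suc) n) (den≤num b b>0 (suc n))

  -- ∣ h/k - H/K ∣ ≤ y/(kK), where y is small compared with H/h and K/k.
  record Close (h k H K : ℕ) : Set where
    field
      y   : ℕ
      Kh≤ : K * h ≤ k * H + y
      kH≤ : k * H ≤ K * h + y
      hy≤ : h * y ≤ H
      ky≤ : k * y ≤ K

  -- Induction on `m`: prefixing a quotient β sends h/k to (βh + k)/h and H/K to (βH + K)/H. This
  -- reverses the order of the two fractions, so `Kh≤` and `kH≤` change places, while `y` is kept.
  -- The old `hy≤` becomes the new `ky≤`.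
  close : ∀ b → (∀ i → ℤ.Positive (b i)) → ∀ m d →
          Close (num b m) (den b m) (num b (suc m + d)) (den b (suc m + d))
  close b b>0 zero d = record
    -- The fractions are β/1 and (βH + K)/H, whose cross products differ by exactly `K`.
    { y   = K
    ; Kh≤ = ≤-trans (≤-reflexive (*-comm H β)) (≤-trans (m≤m+n (β * H) K)
              (≤-trans (≤-reflexive (sym (*-identityˡ _))) (m≤m+n _ K)))
    ; kH≤ = ≤-reflexive (trans (*-identityˡ _) (cong (_+ K) (*-comm β H)))
    ; hy≤ = ≤-trans (*-monoʳ-≤ β K≤H) (m≤m+n (β * H) K)
    ; ky≤ = ≤-trans (≤-reflexive (*-identityˡ K)) K≤H
    }
    where
    β = ℤ.∣ b 0 ∣
    H = num (b ∘ suc) d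
    K = den (b ∘ suc) d
    K≤H = den≤num (b ∘ suc) (b>0 ∘ suc) d
  close b b>0 (suc m) d = record
    { y   = y
    ; Kh≤ = step₁ β h k H K y kH≤
    ; kH≤ = step₂ β h k H K y Kh≤
    ; hy≤ = ≤-trans (≤-reflexive (distrib β h k y)) (+-mono-≤ (*-monoʳ-≤ β hy≤) ky≤)
    ; ky≤ = hy≤
    }
    where
    β = ℤ.∣ b 0 ∣
    h = num (b ∘ suc) m
    k = den (b ∘ suc) m
    H = num (b ∘ suc) (suc m + d)
    K = den (b ∘ suc) (suc m + d)
    open Close (close (b ∘ suc) (b>0 ∘ suc) m d)
    distrib : ∀ β h k y → (β * h + k) * y ≡ β * (h * y) + k * y
    distrib = solve-∀
    step₁ : ∀ β h k H K y → k * H ≤ K * h + y → H * (β * h + k) ≤ h * (β * H + K) + y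
    step₁ β h k H K y le = begin
      H * (β * h + k)              ≡⟨ eq₁ β h k H ⟩
      β * h * H + k * H            ≤⟨ +-monoʳ-≤ (β * h * H) le ⟩
      β * h * H + (K * h + y)      ≡⟨ eq₂ β h H K y ⟩
      h * (β * H + K) + y          ∎
      where
      open ≤-Reasoning
      eq₁ : ∀ β h k H → H * (β * h + k) ≡ β * h * H + k * H
      eq₁ = solve-∀
      eq₂ : ∀ β h H K y → β * h * H + (K * h + y) ≡ h * (β * H + K) + y
      eq₂ = solve-∀
    step₂ : ∀ β h k H K y → K * h ≤ k * H + y → h * (β * H + K) ≤ H * (β * h + k) + y
    step₂ β h k H K y le = begin
      h * (β * H + K)              ≡⟨ eq₁ β h H K ⟩
      β * h * H + K * h            ≤⟨ +-monoʳ-≤ (β * h * H) le ⟩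
      β * h * H + (k * H + y)      ≡⟨ eq₂ β h k H y ⟩
      H * (β * h + k) + y          ∎
      where
      open ≤-Reasoning
      eq₁ : ∀ β h H K → h * (β * H + K) ≡ β * h * H + K * h
      eq₁ = solve-∀
      eq₂ : ∀ β h k H y → β * h * H + (k * H + y) ≡ H * (β * h + k) + y
      eq₂ = solve-∀

  -- The common factor of `A n` and `n !`.

  D : ℕ → ℕ
  D n = gcd (A n) (n !)

  -- `n !` divides both `q * A n` and `q * n !`, hence `q * D n`. Squaring `n ! ≤ q * D n` and
  -- inserting the bound on `q * q` leaves one factor `n !` to cancel.
  D-large : ∀ n q → 1 ≤ q → n ! ∣ A n * q → q * q ≤ 2 * suc n ! → n ! ≤ 2 * suc n * (D n * D n)
  D-large n q 1≤q n!∣Anq q²≤ = *-cancelʳ-≤ F _ F {{F≢0}} (begin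
    F * F                               ≤⟨ *-mono-≤ F≤qD F≤qD ⟩
    q * D n * (q * D n)                 ≡⟨ [m*n]*[o*p]≡[m*o]*[n*p] q (D n) q (D n) ⟩
    q * q * (D n * D n)                 ≤⟨ *-monoˡ-≤ (D n * D n) q²≤ ⟩
    2 * (suc n * F) * (D n * D n)       ≡⟨ rearrange (suc n) F (D n * D n) ⟩
    2 * suc n * (D n * D n) * F         ∎)
    where
    open ≤-Reasoning
    F = n !
    F≢0 : NonZero F
    F≢0 = n !≢0
    D≢0 : NonZero (D n)
    D≢0 = ≢-nonZero λ D≡0 → ≢-nonZero⁻¹ F {{F≢0}} (gcd[m,n]≡0⇒n≡0 (A n) D≡0)
    F≤qD : F ≤ q * D n
    F≤qD = ∣⇒≤ {{m*n≢0 q (D n) {{>-nonZero 1≤q}} {{D≢0}}}}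
      (subst (F ∣_) (sym (c*gcd[m,n]≡gcd[cm,cn] q (A n) F))
        (gcd-greatest (subst (F ∣_) (*-comm (A n) q) n!∣Anq) (n∣m*n q)))
    rearrange : ∀ a b c → 2 * (a * b) * c ≡ 2 * a * c * b
    rearrange = solve-∀

  -- With `T = k + n`, the power `T ^ k` bounds both the pairwise gcds and the ratio of `T !` to
  -- `n !`. The exponent `3 + k * 8` is that of T in T³ (Tᵏ)⁸.
  no-three-large : ∀ k n {x y z} → factorialThreshold k (3 + k * 8) ≤ n →
    n ≤ x → x < y → y < z → z < k + n →
    x ! ≤ 2 * suc x * (D x * D x) → y ! ≤ 2 * suc y * (D y * D y) → z ! ≤ 2 * suc z * (D z * D z) → ⊥
  no-three-large k n {x} {y} {z} n₀≤n n≤x x<y y<z z<T x!≤ y!≤ z!≤ =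
    <-irrefl refl (<-≤-trans (factorial-beats-power k (3 + k * 8) n n₀≤n) (subst (n ! ≤_) T^≡ n!≤))
    where
    T = k + n
    y<T = <-trans y<z z<T
    x<T = <-trans x<y y<T
    n≤y = ≤-trans n≤x (<⇒≤ x<y)
    n≤z = ≤-trans n≤y (<⇒≤ y<z)
    D∣T! : ∀ {i} → i < T → D i ∣ T !
    D∣T! {i} i<T = ∣-trans (gcd[m,n]∣n (A i) (i !)) (m≤n⇒m!∣n! (<⇒≤ i<T))
    gcd-D≤ : ∀ {i j} → n ≤ i → i < j → j < T → gcd (D i) (D j) ≤ T ^ k
    gcd-D≤ {i} {j} n≤i i<j j<T = common-divisor-bound i<j j<T
      (subst (j ∸ i ≤_) (m+n∸n≡m k n) (∸-mono (<⇒≤ j<T) n≤i))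
      (∣-trans (gcd[m,n]∣m (D i) (D j)) (gcd[m,n]∣m (A i) (i !)))
      (∣-trans (gcd[m,n]∣n (D i) (D j)) (gcd[m,n]∣m (A j) (j !)))
    n!≤2TD² : ∀ {i} → n ≤ i → i < T → i ! ≤ 2 * suc i * (D i * D i) → n ! ≤ 2 * T * (D i * D i)
    n!≤2TD² {i} n≤i i<T i!≤ = ≤-trans (∣⇒≤ {{i !≢0}} (m≤n⇒m!∣n! n≤i))
      (≤-trans i!≤ (*-monoˡ-≤ (D i * D i) (*-monoʳ-≤ 2 i<T)))
    n!≤ : n ! ≤ 8 * (T ^ 3 * (T ^ k) ^ 8)
    n!≤ = three-large-divisors {T = T} {{T !≢0}} {{n !≢0}} (D∣T! x<T) (D∣T! y<T) (D∣T! z<T)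
      ([k+n]!≤[k+n]^k*n! k n)
      (gcd-D≤ n≤x x<y y<T) (gcd-D≤ n≤x (<-trans x<y y<z) z<T) (gcd-D≤ n≤y y<z z<T)
      (n!≤2TD² n≤x x<T x!≤) (n!≤2TD² n≤y y<T y!≤) (n!≤2TD² n≤z z<T z!≤)
    T^≡ : 8 * (T ^ 3 * (T ^ k) ^ 8) ≡ 8 * T ^ (3 + k * 8)
    T^≡ = cong (8 *_) (trans (cong (T ^ 3 *_) (^-*-assoc T k 8)) (sym (^-distribˡ-+-* T 3 (k * 8))))

module Approximation where

  open Arithmetic
  open import Data.Integer.Base using (+_; 1ℤ)
  import Data.Integer.Properties as ℤ
  open import Data.Rational.Base
    using (0ℚ; 1ℚ; ½; _/_; _+_; _*_; _-_; -_; 1/_; _≤_; _<_; NonZero; Positive; NonNegative; toℚᵘ)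
    renaming (∣_∣ to ∣_∣ℚ)
  import Data.Rational.Properties as ℚ
  open import Data.Rational.Solver using (module +-*-Solver)
  import Data.Rational.Unnormalised.Base as ℚᵘ
  import Data.Rational.Unnormalised.Properties as ℚᵘ

  -- Integers and naturals inside the rationals.

  ι : ℤ → ℚ
  ι z = z / 1

  ν : ℕ → ℚ
  ν n = ι (+ n)

  -- `_/_` normalises through a gcd and does not compute on variables, so the law is checked on
  -- unnormalised representatives.
  ι-+ : ∀ a b → ι (a ℤ.+ b) ≡ ι a + ι b
  ι-+ a b = ℚ.toℚᵘ-injective (begin
    toℚᵘ (ι (a ℤ.+ b))             ≈⟨ ℚ.toℚᵘ-fromℚᵘ (ℚᵘ.mkℚᵘ (a ℤ.+ b) 0) ⟩
    ℚᵘ.mkℚᵘ (a ℤ.+ b) 0            ≡⟨ cong₂ (λ x y → ℚᵘ.mkℚᵘ (x ℤ.+ y) 0) (ℤ.*-identityʳ a) (ℤ.*-identityʳ b) ⟨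
    ℚᵘ.mkℚᵘ a 0 ℚᵘ.+ ℚᵘ.mkℚᵘ b 0   ≈⟨ ℚᵘ.+-cong (ℚ.toℚᵘ-fromℚᵘ (ℚᵘ.mkℚᵘ a 0)) (ℚ.toℚᵘ-fromℚᵘ (ℚᵘ.mkℚᵘ b 0)) ⟨
    toℚᵘ (ι a) ℚᵘ.+ toℚᵘ (ι b)     ≈⟨ ℚ.toℚᵘ-homo-+ (ι a) (ι b) ⟨
    toℚᵘ (ι a + ι b)               ∎)
    where open ℚᵘ.≃-Reasoning

  ι-* : ∀ a b → ι (a ℤ.* b) ≡ ι a * ι b
  ι-* a b = ℚ.toℚᵘ-injective (begin
    toℚᵘ (ι (a ℤ.* b))             ≈⟨ ℚ.toℚᵘ-fromℚᵘ (ℚᵘ.mkℚᵘ (a ℤ.* b) 0) ⟩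
    ℚᵘ.mkℚᵘ a 0 ℚᵘ.* ℚᵘ.mkℚᵘ b 0   ≈⟨ ℚᵘ.*-cong (ℚ.toℚᵘ-fromℚᵘ (ℚᵘ.mkℚᵘ a 0)) (ℚ.toℚᵘ-fromℚᵘ (ℚᵘ.mkℚᵘ b 0)) ⟨
    toℚᵘ (ι a) ℚᵘ.* toℚᵘ (ι b)     ≈⟨ ℚ.toℚᵘ-homo-* (ι a) (ι b) ⟨
    toℚᵘ (ι a * ι b)               ∎)
    where open ℚᵘ.≃-Reasoning

  ι-injective : ∀ {a b} → ι a ≡ ι b → a ≡ b
  ι-injective {a} {b} eq with ℚᵘ.*≡* a1≡b1 ← ℚᵘ.≃-trans (ℚᵘ.≃-sym (ℚ.toℚᵘ-fromℚᵘ (ℚᵘ.mkℚᵘ a 0)))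
      (ℚᵘ.≃-trans (ℚᵘ.≃-reflexive (cong toℚᵘ eq)) (ℚ.toℚᵘ-fromℚᵘ (ℚᵘ.mkℚᵘ b 0)))
    = trans (sym (ℤ.*-identityʳ a)) (trans a1≡b1 (ℤ.*-identityʳ b))

  ν-+ : ∀ m n → ν (m ℕ.+ n) ≡ ν m + ν n
  ν-+ m n = ι-+ (+ m) (+ n)

  ν-* : ∀ m n → ν (m ℕ.* n) ≡ ν m * ν n
  ν-* m n = trans (cong ι (ℤ.pos-* m n)) (ι-* (+ m) (+ n))

  ν-mono-≤ : ∀ {m n} → m ℕ.≤ n → ν m ≤ ν n
  ν-mono-≤ {m} {n} m≤n = ℚ.toℚᵘ-cancel-≤ (begin
    toℚᵘ (ν m)          ≃⟨ ℚ.toℚᵘ-fromℚᵘ (ℚᵘ.mkℚᵘ (+ m) 0) ⟩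
    ℚᵘ.mkℚᵘ (+ m) 0     ≤⟨ ℚᵘ.*≤* (ℤ.*-monoʳ-≤-nonNeg (+ 1) (ℤ.+≤+ m≤n)) ⟩
    ℚᵘ.mkℚᵘ (+ n) 0     ≃⟨ ℚ.toℚᵘ-fromℚᵘ (ℚᵘ.mkℚᵘ (+ n) 0) ⟨
    toℚᵘ (ν n)          ∎)
    where open ℚᵘ.≤-Reasoning

  ν-cancel-≤ : ∀ {m n} → ν m ≤ ν n → m ℕ.≤ n
  ν-cancel-≤ {m} {n} νm≤νn with ℕ.≤-total m n
  ... | inj₁ m≤n = m≤n
  ... | inj₂ n≤m = ℕ.≤-reflexive (ℤ.+-injective (ι-injective (ℚ.≤-antisym νm≤νn (ν-mono-≤ n≤m))))

  ν-pos : ∀ n .{{_ : ℕ.NonZero n}} → Positive (ν n)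
  ν-pos n = ℚ.normalize-pos n 1

  ν-nonNeg : ∀ n → NonNegative (ν n)
  ν-nonNeg n = ℚ.normalize-nonNeg n 1

  recip-mul : ∀ r {p q} .{{_ : NonZero r}} → r * q ≡ p → (1/ r) * p ≡ q
  recip-mul r {p} {q} rq≡p = begin
    (1/ r) * p          ≡⟨ cong ((1/ r) *_) rq≡p ⟨
    (1/ r) * (r * q)    ≡⟨ ℚ.*-assoc (1/ r) r q ⟨
    (1/ r) * r * q      ≡⟨ cong (_* q) (ℚ.*-inverseˡ r) ⟩
    1ℚ * q              ≡⟨ ℚ.*-identityˡ q ⟩
    q                   ∎
    where open ≡-Reasoning

  -- Truncations as fractions, and their distance from later truncations.

  +∣pos∣ : ∀ z → ℤ.Positive z → + ℤ.∣ z ∣ ≡ z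
  +∣pos∣ +[1+ _ ] _ = refl

  nested-num-den : ∀ b b>0 n → nested b b>0 n * ν (den b n) ≡ ν (num b n)
  nested-num-den b b>0 zero    = trans (ℚ.*-identityʳ (ι (b 0))) (cong ι (sym (+∣pos∣ (b 0) (b>0 0))))
  nested-num-den b b>0 (suc n) = begin
    (ι (b 0) + (1/ r) {{r≢0}}) * ν h            ≡⟨ ℚ.*-distribʳ-+ (ν h) (ι (b 0)) ((1/ r) {{r≢0}}) ⟩
    ι (b 0) * ν h + (1/ r) {{r≢0}} * ν h        ≡⟨ cong₂ (λ x y → ι x * ν h + y) (sym (+∣pos∣ (b 0) (b>0 0))) (recip-mul r {{r≢0}} (nested-num-den (b ∘ suc) (b>0 ∘ suc) n)) ⟩
    ν ℤ.∣ b 0 ∣ * ν h + ν k                     ≡⟨ cong (_+ ν k) (ν-* ℤ.∣ b 0 ∣ h) ⟨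
    ν (ℤ.∣ b 0 ∣ ℕ.* h) + ν k                   ≡⟨ ν-+ (ℤ.∣ b 0 ∣ ℕ.* h) k ⟨
    ν (ℤ.∣ b 0 ∣ ℕ.* h ℕ.+ k)                   ∎
    where
    open ≡-Reasoning
    r = nested (b ∘ suc) (b>0 ∘ suc) n
    r≢0 : NonZero r
    r≢0 = ℚ.pos⇒nonZero r {{nested-pos (b ∘ suc) (b>0 ∘ suc) n}}
    h = num (b ∘ suc) n
    k = den (b ∘ suc) n

  x+y-x≡y : ∀ x y → x + y - x ≡ y
  x+y-x≡y = solve 2 (λ x y → x :+ y :- x := y) refl
    where open +-*-Solver

  x*n≤n⇒x≤1 : ∀ x H .{{_ : ℕ.NonZero H}} → x * ν H ≤ ν H → x ≤ 1ℚ
  x*n≤n⇒x≤1 x H xH≤H = ℚ.*-cancelʳ-≤-pos (ν H) {{ν-pos H}} (subst (x * ν H ≤_) (sym (ℚ.*-identityˡ (ν H))) xH≤H)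

  -- p and q need not be coprime: any denominator q of a fraction equal to s n serves to bound
  -- the reduced one.
  record GoodFraction (c : SimpleContinuedFraction) (m : ℕ) : Set where
    field
      p     : ℤ
      q     : ℕ
      1≤q   : 1 ℕ.≤ q
      tq≡p  : truncate c m * ν q ≡ ι p
      later : ∀ M → m ℕ.< M → (truncate c M - truncate c m) * ν (q ℕ.* q) ≤ 1ℚ

  -- `a 0` may be any integer, so `num` and `den` describe only the tail. Two truncations differ by
  -- K/H - k/h ≤ y/(hH), which is at most 1/h² by `hy≤`. An upper bound on the signed difference is
  -- enough, since the partial sums approach e from below.
  truncate-good : ∀ c m → GoodFraction c m
  truncate-good c zero = record
    { p = a 0 ; q = 1 ; 1≤q = s≤s z≤n ; tq≡p = ℚ.*-identityʳ (ι (a 0)) ; later = later }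
    where
    open SimpleContinuedFraction c
    later : ∀ M → 0 ℕ.< M → (truncate c M - truncate c 0) * 1ℚ ≤ 1ℚ
    -- The difference is the reciprocal of a tail, and a tail is at least 1 by `den≤num`.
    later (suc M) _ = subst (_≤ 1ℚ) (sym (trans (ℚ.*-identityʳ _) (x+y-x≡y (ι (a 0)) u)))
      (x*n≤n⇒x≤1 u H {{ℕ.>-nonZero (1≤num (a ∘ suc) a>0 M)}}
        (subst (_≤ ν H) (sym (recip-mul r {{r≢0}} (nested-num-den (a ∘ suc) a>0 M)))
          (ν-mono-≤ (den≤num (a ∘ suc) a>0 M))))
      where
      r = nested (a ∘ suc) a>0 M
      r≢0 : NonZero r
      r≢0 = ℚ.pos⇒nonZero r {{nested-pos (a ∘ suc) a>0 M}}
      u = (1/ r) {{r≢0}}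
      H = num (a ∘ suc) M
  truncate-good c (suc m) = record
    { p = a 0 ℤ.* + h ℤ.+ + k ; q = h ; 1≤q = 1≤num (a ∘ suc) a>0 m ; tq≡p = tq≡p ; later = later }
    where
    open SimpleContinuedFraction c
    r : ℕ → ℚ
    r = nested (a ∘ suc) a>0
    r≢0 : ∀ n → NonZero (r n)
    r≢0 n = ℚ.pos⇒nonZero (r n) {{nested-pos (a ∘ suc) a>0 n}}
    u : ℕ → ℚ
    u n = (1/ r n) {{r≢0 n}}
    u*num : ∀ n → u n * ν (num (a ∘ suc) n) ≡ ν (den (a ∘ suc) n)
    u*num n = recip-mul (r n) {{r≢0 n}} (nested-num-den (a ∘ suc) a>0 n)
    h = num (a ∘ suc) m
    k = den (a ∘ suc) m
    tq≡p : (ι (a 0) + u m) * ν h ≡ ι (a 0 ℤ.* + h ℤ.+ + k)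
    tq≡p = begin
      (ι (a 0) + u m) * ν h           ≡⟨ ℚ.*-distribʳ-+ (ν h) (ι (a 0)) (u m) ⟩
      ι (a 0) * ν h + u m * ν h       ≡⟨ cong₂ _+_ (sym (ι-* (a 0) (+ h))) (u*num m) ⟩
      ι (a 0 ℤ.* + h) + ν k           ≡⟨ ι-+ (a 0 ℤ.* + h) (+ k) ⟨
      ι (a 0 ℤ.* + h ℤ.+ + k)         ∎
      where open ≡-Reasoning
    later : ∀ M → suc m ℕ.< M → (truncate c M - truncate c (suc m)) * ν (h ℕ.* h) ≤ 1ℚ
    later (suc M) (s≤s m<M) = x*n≤n⇒x≤1 _ H {{ℕ.>-nonZero (1≤num (a ∘ suc) a>0 M)}} (begin
      (ι (a 0) + u M - (ι (a 0) + u m)) * ν (h ℕ.* h) * ν H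
        ≡⟨ cong (λ x → (ι (a 0) + u M - (ι (a 0) + u m)) * x * ν H) (ν-* h h) ⟩
      (ι (a 0) + u M - (ι (a 0) + u m)) * (ν h * ν h) * ν H
        ≡⟨ rearrange (ι (a 0)) (u M) (u m) (ν h) (ν H) ⟩
      (u M * ν H * ν h - u m * ν h * ν H) * ν h
        ≡⟨ cong₂ (λ x y → (x * ν h - y * ν H) * ν h) (u*num M) (u*num m) ⟩
      (ν K * ν h - ν k * ν H) * ν h
        ≡⟨ cong₂ (λ x y → (x - y) * ν h) (sym (ν-* K h)) (sym (ν-* k H)) ⟩
      (ν (K ℕ.* h) - ν (k ℕ.* H)) * ν h
        ≤⟨ ℚ.*-monoʳ-≤-nonNeg (ν h) {{ν-nonNeg h}} (ℚ.+-monoˡ-≤ (- ν (k ℕ.* H)) (ν-mono-≤ Kh≤)) ⟩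
      (ν (k ℕ.* H ℕ.+ y) - ν (k ℕ.* H)) * ν h
        ≡⟨ cong (λ x → (x - ν (k ℕ.* H)) * ν h) (ν-+ (k ℕ.* H) y) ⟩
      (ν (k ℕ.* H) + ν y - ν (k ℕ.* H)) * ν h
        ≡⟨ cong (_* ν h) (x+y-x≡y (ν (k ℕ.* H)) (ν y)) ⟩
      ν y * ν h
        ≡⟨ ν-* y h ⟨
      ν (y ℕ.* h)
        ≤⟨ ν-mono-≤ (subst (ℕ._≤ H) (ℕ.*-comm h y) hy≤) ⟩
      ν H ∎)
      where
      open ℚ.≤-Reasoning
      H = num (a ∘ suc) M
      K = den (a ∘ suc) M
      -- `truncate c (suc M)` has a tail of index `M`, which is `suc m + d` for `d = M ∸ suc m`.
      open Close (subst (λ n → Close h k (num (a ∘ suc) n) (den (a ∘ suc) n)) (ℕ.m+[n∸m]≡n m<M)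
                        (close (a ∘ suc) a>0 m (M ℕ.∸ suc m)))
      rearrange : ∀ a u′ u h H → (a + u′ - (a + u)) * (h * h) * H ≡ (u′ * H * h - u * h * H) * h
      rearrange = solve 5 (λ a u′ u h H →
        (a :+ u′ :- (a :+ u)) :* (h :* h) :* H := (u′ :* H :* h :- u :* h :* H) :* h) refl
        where open +-*-Solver

  -- Partial sums that are convergents of e.

  inv!*n! : ∀ n → inv! n * ν (n !) ≡ 1ℚ
  inv!*n! n = ℚ.toℚᵘ-injective (begin
    toℚᵘ (inv! n * ν (n !))                    ≈⟨ ℚ.toℚᵘ-homo-* (inv! n) (ν (n !)) ⟩
    toℚᵘ (inv! n) ℚᵘ.* toℚᵘ (ν (n !))          ≈⟨ unit (n !) {{n !≢0}} ⟩
    toℚᵘ 1ℚ                                    ∎)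
    where
    open ℚᵘ.≃-Reasoning
    unit : ∀ N .{{_ : ℕ.NonZero N}} → toℚᵘ (1ℤ / N) ℚᵘ.* toℚᵘ (ν N) ℚᵘ.≃ ℚᵘ.1ℚᵘ
    unit (suc N) = begin
      toℚᵘ (1ℤ / suc N) ℚᵘ.* toℚᵘ (ν (suc N))
        ≈⟨ ℚᵘ.*-cong (ℚ.toℚᵘ-fromℚᵘ (ℚᵘ.mkℚᵘ 1ℤ N)) (ℚ.toℚᵘ-fromℚᵘ (ℚᵘ.mkℚᵘ (+ suc N) 0)) ⟩
      ℚᵘ.mkℚᵘ 1ℤ N ℚᵘ.* ℚᵘ.mkℚᵘ (+ suc N) 0
        ≈⟨ ℚᵘ.*-inverseˡ (ℚᵘ.mkℚᵘ (+ suc N) 0) ⟩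
      ℚᵘ.1ℚᵘ ∎

  s*n! : ∀ n → s n * ν (n !) ≡ ν (A n)
  s*n! zero    = refl
  s*n! (suc n) = begin
    (s n + inv! (suc n)) * ν (suc n !)                     ≡⟨ ℚ.*-distribʳ-+ (ν (suc n !)) (s n) (inv! (suc n)) ⟩
    s n * ν (suc n !) + inv! (suc n) * ν (suc n !)         ≡⟨ cong₂ (λ x y → s n * x + y) (ν-* (suc n) (n !)) (inv!*n! (suc n)) ⟩
    s n * (ν (suc n) * ν (n !)) + 1ℚ                       ≡⟨ cong (_+ 1ℚ) (rearrange (s n) (ν (suc n)) (ν (n !))) ⟩
    ν (suc n) * (s n * ν (n !)) + 1ℚ                       ≡⟨ cong (λ x → ν (suc n) * x + 1ℚ) (s*n! n) ⟩
    ν (suc n) * ν (A n) + 1ℚ                               ≡⟨ cong (_+ 1ℚ) (ν-* (suc n) (A n)) ⟨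
    ν (suc n ℕ.* A n) + ν 1                                ≡⟨ ν-+ (suc n ℕ.* A n) 1 ⟨
    ν (suc n ℕ.* A n ℕ.+ 1)                                ∎
    where
    open ≡-Reasoning
    rearrange : ∀ x y z → x * (y * z) ≡ y * (x * z)
    rearrange = solve 3 (λ x y z → x :* (y :* z) := y :* (x :* z)) refl
      where open +-*-Solver

  p≤∣p∣ : ∀ p → p ≤ ∣ p ∣ℚ
  p≤∣p∣ p with ℚ.≤-total 0ℚ p
  ... | inj₁ 0≤p = ℚ.≤-reflexive (sym (ℚ.0≤p⇒∣p∣≡p 0≤p))
  ... | inj₂ p≤0 = ℚ.≤-trans p≤0 (ℚ.0≤∣p∣ p)

  ½inv!>0 : ∀ n → 0ℚ < inv! n * ½
  ½inv!>0 n = ℚ.positive⁻¹ _ {{ℚ.pos*pos⇒pos (inv! n) {{ℚ.normalize-pos 1 (n !) {{n !≢0}}}} ½}}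

  -- With x = s N, y = s n, t = truncate c N, u = truncate c m and i = 1/F = 1/(n+1)!:
  -- i ≤ x - y, and t is within i/2 of x, so that i/2 ≤ t - u ≤ 1/Q.
  denominator-bound : ∀ i x y t u Q F → i * ν F ≡ 1ℚ → i ≤ x - y → ∣ t - x ∣ℚ < i * ½ → y ≡ u →
                      (t - u) * ν Q ≤ 1ℚ → Q ℕ.≤ 2 ℕ.* F
  denominator-bound i x y t u Q F iF≡1 i≤x-y ∣t-x∣<ε y≡u [t-u]Q≤1 = ν-cancel-≤ (begin
    ν Q                                ≡⟨ ℚ.*-identityˡ (ν Q) ⟨
    1ℚ * ν Q                           ≡⟨ cong (_* ν Q) iF≡1 ⟨
    i * ν F * ν Q                      ≡⟨ double i (ν F) (ν Q) ⟩
    ν 2 * ν F * ((i - ε) * ν Q)        ≤⟨ ℚ.*-monoˡ-≤-nonNeg (ν 2 * ν F) {{2F≥0}} [i-ε]Q≤1 ⟩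
    ν 2 * ν F * 1ℚ                     ≡⟨ ℚ.*-identityʳ (ν 2 * ν F) ⟩
    ν 2 * ν F                          ≡⟨ ν-* 2 F ⟨
    ν (2 ℕ.* F)                        ∎)
    where
    open ℚ.≤-Reasoning
    ε = i * ½
    2F≥0 : NonNegative (ν 2 * ν F)
    2F≥0 = subst NonNegative (ν-* 2 F) (ν-nonNeg (2 ℕ.* F))
    flip : ∀ x y → x - y ≡ - (y - x)
    flip = solve 2 (λ x y → x :- y := :- (y :- x)) refl
      where open +-*-Solver
    cancel : ∀ x y z → x - y - (x - z) ≡ z - y
    cancel = solve 3 (λ x y z → x :- y :- (x :- z) := z :- y) refl
      where open +-*-Solver
    double : ∀ i f q → i * f * q ≡ ν 2 * f * ((i - i * ½) * q)
    double = solve 3 (λ i f q → i :* f :* q := con (ν 2) :* f :* ((i :- i :* con ½) :* q)) refl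
      where open +-*-Solver
    x-t≤ε : x - t ≤ ε
    x-t≤ε = begin
      x - t               ≤⟨ p≤∣p∣ (x - t) ⟩
      ∣ x - t ∣ℚ          ≡⟨ cong ∣_∣ℚ (flip x t) ⟩
      ∣ - (t - x) ∣ℚ      ≡⟨ ℚ.∣-p∣≡∣p∣ (t - x) ⟩
      ∣ t - x ∣ℚ          ≤⟨ ℚ.<⇒≤ ∣t-x∣<ε ⟩
      ε                   ∎
    i-ε≤t-u : i - ε ≤ t - u
    i-ε≤t-u = begin
      i - ε                ≤⟨ ℚ.+-mono-≤ i≤x-y (ℚ.neg-antimono-≤ x-t≤ε) ⟩
      x - y - (x - t)      ≡⟨ cancel x y t ⟩
      t - y                ≡⟨ cong (λ z → t - z) y≡u ⟩
      t - u                ∎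
    [i-ε]Q≤1 : (i - ε) * ν Q ≤ 1ℚ
    [i-ε]Q≤1 = ℚ.≤-trans (ℚ.*-monoʳ-≤-nonNeg (ν Q) {{ν-nonNeg Q}} i-ε≤t-u) [t-u]Q≤1

  inv!≤sN-sn : ∀ n N → n ℕ.< N → inv! (suc n) ≤ s N - s n
  inv!≤sN-sn n N n<N =
    subst (_≤ s N - s n) (x+y-x≡y (s n) (inv! (suc n))) (ℚ.+-monoˡ-≤ (- s n) (s-mono (ℕ.≤⇒≤′ n<N)))

  -- The limit e never enters as a number: at one late index `N`, `s N` and `truncate c N` both
  -- stand in for it, and convergence brings them within half of 1/(n+1)! of each other.
  q²≤2[1+n]! : ∀ c n m → c IsExpansionOf e → s n ≡ truncate c m → (g : GoodFraction c m) →
               GoodFraction.q g ℕ.* GoodFraction.q g ℕ.≤ 2 ℕ.* suc n !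
  q²≤2[1+n]! c n m c→e sn≡t g = bound (c→e (inv! (suc n) * ½) (½inv!>0 (suc n)))
    where
    open GoodFraction g
    bound : ∃[ N₀ ] (∀ N → N₀ ℕ.≤ N → ∣ truncate c N - s N ∣ℚ < inv! (suc n) * ½) → q ℕ.* q ℕ.≤ 2 ℕ.* suc n !
    bound (N₀ , near) = denominator-bound (inv! (suc n)) (s N) (s n) (truncate c N) (truncate c m) (q ℕ.* q) (suc n !)
      (inv!*n! (suc n))
      (inv!≤sN-sn n N (ℕ.≤-trans (ℕ.m≤n+m (suc n) N₀) (ℕ.m≤m+n (N₀ ℕ.+ suc n) (suc m))))
      (near N (ℕ.≤-trans (ℕ.m≤m+n N₀ (suc n)) (ℕ.m≤m+n (N₀ ℕ.+ suc n) (suc m))))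
      sn≡t (later N (ℕ.m≤n+m (suc m) (N₀ ℕ.+ suc n)))
      -- At least `N₀` and beyond both `n` and `m`.
      where N = N₀ ℕ.+ suc n ℕ.+ suc m

  -- Cross-multiplying A n / n! = p/q gives `A n * q` = p n! in the integers; absolute values then
  -- give the divisibility.
  convergent⇒bounded-multiple : ∀ n → s n IsConvergentOf e →
    ∃[ q ] 1 ℕ.≤ q × n ! ℕ.∣ A n ℕ.* q × q ℕ.* q ℕ.≤ 2 ℕ.* suc n !
  convergent⇒bounded-multiple n (c , c→e , m , sn≡t) =
    q , 1≤q , ℕ.divides ℤ.∣ p ∣ An*q≡ , q²≤2[1+n]! c n m c→e sn≡t g
    where
    g = truncate-good c m
    open GoodFraction g
    ι-eq : ι (+ A n ℤ.* + q) ≡ ι (p ℤ.* + (n !))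
    ι-eq = begin
      ι (+ A n ℤ.* + q)              ≡⟨ ι-* (+ A n) (+ q) ⟩
      ν (A n) * ν q                  ≡⟨ cong (_* ν q) (s*n! n) ⟨
      s n * ν (n !) * ν q            ≡⟨ rearrange (s n) (ν (n !)) (ν q) ⟩
      s n * ν q * ν (n !)            ≡⟨ cong (λ x → x * ν q * ν (n !)) sn≡t ⟩
      truncate c m * ν q * ν (n !)   ≡⟨ cong (_* ν (n !)) tq≡p ⟩
      ι p * ν (n !)                  ≡⟨ ι-* p (+ (n !)) ⟨
      ι (p ℤ.* + (n !))              ∎
      where
      open ≡-Reasoning
      rearrange : ∀ x y z → x * y * z ≡ x * z * y
      rearrange = solve 3 (λ x y z → x :* y :* z := x :* z :* y) refl
        where open +-*-Solver
    An*q≡ : A n ℕ.* q ≡ ℤ.∣ p ∣ ℕ.* n !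
    An*q≡ = trans (sym (ℤ.abs-* (+ A n) (+ q))) (trans (cong ℤ.∣_∣ (ι-injective {+ A n ℤ.* + q} {p ℤ.* + (n !)} ι-eq)) (ℤ.abs-* p (+ (n !))))

-- Counting the convergents among consecutive partial sums.

open Arithmetic using (D; D-large; no-three-large; factorialThreshold; three-elements)
open Approximation using (convergent⇒bounded-multiple)
open import Data.Nat.Base using (_+_; _*_; _≤_)

convergent⇒D-large : ∀ n → s n IsConvergentOf e → n ! ≤ 2 * suc n * (D n * D n)
convergent⇒D-large n conv =
  let q , 1≤q , n!∣Anq , q²≤ = convergent⇒bounded-multiple n conv in D-large n q 1≤q n!∣Anq q²≤

theorem3p2 : ∀ (k : ℕ) → 1 ≤ k → ∃[ n₀ ] (∀ (n : ℕ) → n₀ ≤ n → AtMost 2 (λ (i : Fin k) → s (n + toℕ i) IsConvergentOf e))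
theorem3p2 k _ = factorialThreshold k (3 + k * 8) , λ n n₀≤n S conv → ℕ.≮⇒≥ λ 3≤∣S∣ →
  let x , y , z , x∈S , y∈S , z∈S , x<y , y<z = three-elements S 3≤∣S∣
      large = λ i i∈S → convergent⇒D-large (n + toℕ i) (conv i i∈S)
  in no-three-large k n n₀≤n (ℕ.m≤m+n n (toℕ x)) (ℕ.+-monoʳ-< n x<y) (ℕ.+-monoʳ-< n y<z)
       (subst (n + toℕ z ℕ.<_) (ℕ.+-comm n k) (ℕ.+-monoʳ-< n (Fin.toℕ<n z)))
       (large x x∈S) (large y y∈S) (large z z∈S)
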